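{- Let $x$ and $y$ be notions of attack such that $x\supseteq y$, and let $P$ be an extended logic program. Then the set of $x/y$-justified arguments associated with $P$ is $x$-consistent.
   Context: Programs. An objective literal is a (ground) atom $A$ or its explicit negation $\neg A$, with the convention $\neg\neg L=L$. A default literal is an expression $not\,L$ with $L$ an objective literal. An extended logic program is a possibly infinite set of (ground) rules $L_0\gets L_1,\dots,L_m,not\,L_{m+1},\dots,not\,L_{m+n}$ ($m,n\ge 0$), each $L_i$ an objective literal; $L_0$ is the head and the rest is the body. Arguments. An argument associated with $P$ is a finite sequence $[r_1,\dots,r_n]$ of rules of $P$ such that for every $i$ and every objective literal $L$ in the body of $r_i$ there is $k>i$ with $head(r_k)=L$. A subargument of $A$ is a subsequence of $A$ which is an argument. A conclusion of $A$ is the head of a rule in $A$. $A$ is minimal for $L$ if $L$ is a conclusion of $A$ and no proper subargument of $A$ has conclusion $L$; $A$ is minimal if it is minimal for some $L$. $\mathit{Args}_P$ is the set of minimal arguments associated with $P$. A notion of attack $x$ assigns to each program $P$ a relation $x_P\subseteq\mathit{Args}_P\times\mathit{Args}_P$; $x\subseteq y$ means $x_P\subseteq y_P$ for all $P$. Justified arguments. For notions of attack $x,y$, an argument $A$ is $x/y$-acceptable wrt. a set $S$ of arguments if for every $B$ with $(B,A)\in x$ there is $C\in S$ with $(C,B)\in y$. $F_{P,x/y}(S)=\{A\in\mathit{Args}_P : A\text{ is }x/y\text{ -acceptable wrt. }S\}$ for $S\subseteq\mathit{Args}_P$, and $J_{x/y}$ is the least fixpoint of the monotone operator $F_{P,x/y}$;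 its elements are the $x/y$-justified arguments. A set of arguments associated with $P$ is $x$-consistent if it does not contain arguments $A$ and $B$ such that $(A,B)\in x_P$. -}

module Defs where

open import Data.Fin using (Fin; _<_)
open import Data.List using (List; length; lookup)
open import Data.List.Membership.Propositional using (_∈_)
open import Data.List.Relation.Binary.Sublist.Propositional using () renaming (_⊆_ to _⊑_)
open import Data.List.Relation.Unary.All using (All)
open import Data.List.Relation.Unary.Any using (Any)
open import Data.Product using (Σ-syntax; ∃-syntax; _×_; _,_; proj₁; proj₂)
open import Level using (Level; suc)
open import Relation.Binary.Core using (Rel)
open import Relation.Binary.PropositionalEquality using (_≡_; _≢_; refl)
open import Relation.Nullary using (¬_)
open import Relation.Unary using (Pred; _⊆_; _≐_)

private variable
  ℓ : Level
  Atom : Set ℓ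

-- Explicit negation is the function `neg` rather than a constructor, so that
-- neg (neg L) and L are the same literal.
data ObjLit (Atom : Set ℓ) : Set ℓ where
  +_ : Atom → ObjLit Atom
  -_ : Atom → ObjLit Atom

neg : ObjLit Atom → ObjLit Atom
neg (+ A) = - A
neg (- A) = + A

neg-involutive : (L : ObjLit Atom) → neg (neg L) ≡ L
neg-involutive (+ A) = refl
neg-involutive (- A) = refl

data DefLit (Atom : Set ℓ) : Set ℓ where
  not : ObjLit Atom → DefLit Atom

record Rule (Atom : Set ℓ) : Set ℓ where
  constructor _⟵_,_
  field
    head    : ObjLit Atom
    objBody : List (ObjLit Atom)
    defBody : List (DefLit Atom)

open Rule public

Program : Set ℓ → Set (suc ℓ)
Program {ℓ} Atom = Pred (Rule Atom) ℓ

RuleSeq : Set ℓ → Set ℓ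
RuleSeq Atom = List (Rule Atom)

module _ {Atom : Set ℓ} where

  IsArgument : Program Atom → Pred (RuleSeq Atom) ℓ
  IsArgument P A =
    All P A ×
    (∀ (i : Fin (length A)) (L : ObjLit Atom) → L ∈ objBody (lookup A i) →
       Σ[ k ∈ Fin (length A) ] (i < k × head (lookup A k) ≡ L))

  IsSubargument : Program Atom → Rel (RuleSeq Atom) ℓ
  IsSubargument P B A = B ⊑ A × IsArgument P B

  IsConclusion : ObjLit Atom → Pred (RuleSeq Atom) ℓ
  IsConclusion L A = Any (λ r → head r ≡ L) A

  MinimalFor : Program Atom → ObjLit Atom → Pred (RuleSeq Atom) ℓ
  MinimalFor P L A =
    IsConclusion L A ×
    (∀ B → IsSubargument P B A → B ≢ A → ¬ IsConclusion L B)

  Args : Program Atom → Pred (RuleSeq Atom) ℓ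
  Args P A = IsArgument P A × ∃[ L ] MinimalFor P L A

record Attack (Atom : Set ℓ) : Set (suc ℓ) where
  field
    rel    : Program Atom → Rel (RuleSeq Atom) ℓ
    onArgs : ∀ {P A B} → rel P A B → Args P A × Args P B

open Attack public

module _ {Atom : Set ℓ} where

  infix 4 _⊇ᵃ_
  _⊇ᵃ_ : Attack Atom → Attack Atom → Set (suc ℓ)
  x ⊇ᵃ y = ∀ P {A B} → rel y P A B → rel x P A B

  Acceptable : (x y : Attack Atom) (P : Program Atom) →
               Pred (RuleSeq Atom) ℓ → Pred (RuleSeq Atom) ℓ
  Acceptable x y P S A = ∀ B → rel x P B A → ∃[ C ] (S C × rel y P C B)

  F : (x y : Attack Atom) (P : Program Atom) →
      Pred (RuleSeq Atom) ℓ → Pred (RuleSeq Atom) ℓ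
  F x y P S A = Args P A × Acceptable x y P S A

  F-mono : ∀ x y P {S T} → S ⊆ T → F x y P S ⊆ F x y P T
  F-mono x y P S⊆T (a , acc) =
    a , λ B b → let (C , s , c) = acc B b in C , S⊆T s , c

  -- The inductive type generated by F; `J-isLeastFixpoint` below identifies it
  -- as the least fixpoint of F.
  data J (x y : Attack Atom) (P : Program Atom) : Pred (RuleSeq Atom) ℓ where
    fold : ∀ {A} → F x y P (J x y P) A → J x y P A

  -- Every S ≐ F S is contained in Args P, so ranging over all S here is the
  -- same as ranging over subsets of Args P.
  IsLeastFixpoint : (Pred (RuleSeq Atom) ℓ → Pred (RuleSeq Atom) ℓ) →
                    Pred (RuleSeq Atom) ℓ → Set (suc ℓ)
  IsLeastFixpoint Φ S = Φ S ≐ S × (∀ T → Φ T ≐ T → S ⊆ T)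

  J-least : ∀ x y P {S} → F x y P S ⊆ S → J x y P ⊆ S
  J-least x y P FS⊆S (fold (a , acc)) =
    FS⊆S (a , λ B b → let (C , j , c) = acc B b in C , J-least x y P FS⊆S j , c)

  J-isLeastFixpoint : ∀ x y P → IsLeastFixpoint (F x y P) (J x y P)
  J-isLeastFixpoint x y P =
    (fold , λ { (fold f) → f }) , λ T T-fix → J-least x y P (proj₁ T-fix)

  Consistent : Attack Atom → Program Atom → Pred (RuleSeq Atom) ℓ → Set ℓ
  Consistent x P S = ¬ (∃[ A ] ∃[ B ] (S A × S B × rel x P A B))

{-# OPTIONS --safe #-}
module Submission where

open import Defs
open import Data.Empty using (⊥)
open import Data.Product using (_,_)

-- If A attacks B and both are justified, then some justified C y-attacks A,
-- hence x-attacks it, and C entered the least fixpoint before B. So (A , B)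
-- gives way to the conflict (C , A), an infinite descent.
justified-conflict-free : ∀ {ℓ} {Atom : Set ℓ} (x y : Attack Atom) → x ⊇ᵃ y →
    (P : Program Atom) → ∀ {A B} → J x y P A → J x y P B → rel x P A B → ⊥
justified-conflict-free x y x⊇y P {A} jA (fold (_ , accB)) A→B =
  let (C , jC , C→A) = accB A A→B
  -- The derivations trade places: `jC`, extracted from the derivation of `B`, goes first, and `jA`
  -- moves unchanged to second, so that the acceptability of `A` answers the next attack. One call
  -- need not shrink either position, but two successive calls shrink both, so the descent is
  -- well-founded.
  in justified-conflict-free x y x⊇y P jC jA (x⊇y P C→A)

theorem14 : ∀ {ℓ} {Atom : Set ℓ} (x y : Attack Atom) → x ⊇ᵃ y →
    (P : Program Atom) → Consistent x P (J x y P)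
theorem14 x y x⊇y P (A , B , jA , jB , A→B) =
  justified-conflict-free x y x⊇y P jA jB A→B
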